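{- For every odd period $\Delta\ge 1$ and minimum slack $k=0$ there is a gadget $G_{\Delta,0}$, i.e. a realizable instance of $\Delta$-$0$-DiTTR, that enforces $\lambda(v_1,v_2)=\lambda(v_2,v_1)$ for some pair of adjacent vertices $(v_1,v_2)$.
   Context: All graphs are finite. A $\Delta$-periodic labeling of a directed graph $G=(V,E)$ is a map $\lambda:E\to\{0,1,\dots,\Delta-1\}$; edge $e$ is then active exactly at the times $\lambda(e)+i\Delta$, $i\in\mathbb{N}_0$. A temporal $s$-$z$-path is a sequence $(v_{i-1},v_i,t_i)_{i=1}^{\ell}$ with $v_0=s$, $v_\ell=z$, pairwise distinct vertices $v_0,\dots,v_\ell$, $(v_{i-1},v_i)\in E$ active at time $t_i$ for every $i$, and $t_1<t_2<\dots<t_\ell$ (strictly increasing). Its duration is $t_\ell+1-t_1$. A fastest temporal path is one of minimum duration. $\hat d(u,v)$ is the distance from $u$ to $v$ in the static graph $G$ (all edges have unit length). A bidirected tree is the directed graph obtained from an undirected tree by replacing each edge $\{u,v\}$ by the two directed edges $(u,v),(v,u)$ (which may get different labels). For integers $\Delta\ge1,k\ge0$, an instance of $\Delta$-$k$-DiTTR consists of a bidirected tree $G=(V,E)$ and a matrix $D$ indexed by $V\times V$ with entries positive integers or $\infty$ (no restriction) such that $D_{u,v}\ge\hat d(u,v)+k$ for all $u,v$. A valid labeling is a $\Delta$-periodic labeling $\lambda$ of $E$ such that, for all $u,v\in V$, the duration of a fastest temporal path from $u$ to $v$ is at most $D_{u,v}$; the instance is realizable if a valid labeling exists. Diagonal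 entries of $D$ play no role; all conditions on $D$ are for distinct vertices. An instance enforces $\lambda(v_1,v_2)=\lambda(v_2,v_1)$ if this equality holds for every valid labeling $\lambda$. -}

module Defs where

open import Data.Bool using (Bool; T)
open import Data.Fin using (Fin; toℕ)
open import Data.List using (List; []; _∷_)
open import Data.List.Relation.Unary.Linked using (Linked)
open import Data.List.Relation.Unary.Unique.Propositional using (Unique)
open import Data.Nat using (ℕ; suc; _+_; _*_; _∸_; _≤_; _<_; NonZero)
open import Data.Product using (Σ-syntax; ∃-syntax; _×_)
open import Level using (0ℓ)
open import Relation.Binary using (Rel)
open import Relation.Binary.Construct.Add.Supremum.NonStrict _≤_ using (_≤⁺_)
open import Relation.Binary.Construct.Closure.ReflexiveTransitive using (Star; ε; _◅_)
open import Relation.Binary.Construct.Closure.Transitive using (TransClosure; [_]; _∷_)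
open import Relation.Binary.PropositionalEquality using (_≡_; _≢_)
open import Relation.Nullary using (¬_)
open import Relation.Nullary.Construct.Add.Supremum using (_⁺; [_])

record Digraph : Set where
  field
    order : ℕ
    arc?  : Fin order → Fin order → Bool

  Vertex : Set
  Vertex = Fin order

  Arc : Rel Vertex 0ℓ
  Arc u v = T (arc? u v)

module _ {A : Set} {R : Rel A 0ℓ} where

  length : ∀ {u v} → Star R u v → ℕ
  length ε       = 0
  length (_ ◅ w) = suc (length w)

  vertices : ∀ {u v} → Star R u v → List A
  vertices {u} ε       = u ∷ []
  vertices {u} (_ ◅ w) = u ∷ vertices w

IsDistance : (G : Digraph) (u v : Digraph.Vertex G) → ℕ → Set
IsDistance G u v d =
  (Σ[ w ∈ Star (Digraph.Arc G) u v ] length w ≡ d) ×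
  (∀ (w : Star (Digraph.Arc G) u v) → d ≤ length w)

record SimpleGraph : Set where
  field
    order : ℕ
    adj?  : Fin order → Fin order → Bool

  Vertex : Set
  Vertex = Fin order

  Adj : Rel Vertex 0ℓ
  Adj u v = T (adj? u v)

  field
    adj-sym    : ∀ {u v} → Adj u v → Adj v u
    adj-irrefl : ∀ {u} → ¬ Adj u u

-- Each undirected edge {u , v} appears in the adjacency relation as both
-- (u , v) and (v , u); these become two distinct arcs.
bidirected : SimpleGraph → Digraph
bidirected G = record { order = order ; arc? = adj? }
  where open SimpleGraph G

record IsTree (G : SimpleGraph) : Set where
  open SimpleGraph G
  field
    nonempty  : NonZero order
    connected : ∀ u v → Star Adj u v
    -- A cycle is a path with at least two edges whose endpoints are adjacent.
    acyclic   : ∀ {u v} (p : Star Adj u v) → Unique (vertices p) →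
                2 ≤ length p → ¬ Adj v u

Labeling : Digraph → ℕ → Set
Labeling G Δ = (u v : Vertex) → Arc u v → Fin Δ
  where open Digraph G

module _ (G : Digraph) {Δ : ℕ} (lab : Labeling G Δ) where
  open Digraph G

  record TimeArc (u v : Vertex) : Set where
    field
      arc    : Arc u v
      time   : ℕ
      active : ∃[ i ] time ≡ toℕ (lab u v arc) + i * Δ

  open TimeArc

  pathVertices : ∀ {s z} → TransClosure TimeArc s z → List Vertex
  pathVertices {s} {z} [ a ]   = s ∷ z ∷ []
  pathVertices {s}     (a ∷ p) = s ∷ pathVertices p

  times : ∀ {s z} → TransClosure TimeArc s z → List ℕ
  times [ a ]   = time a ∷ []
  times (a ∷ p) = time a ∷ times p

  firstTime : ∀ {s z} → TransClosure TimeArc s z → ℕ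
  firstTime [ a ]   = time a
  firstTime (a ∷ _) = time a

  lastTime : ∀ {s z} → TransClosure TimeArc s z → ℕ
  lastTime [ a ]   = time a
  lastTime (_ ∷ p) = lastTime p

  record TemporalPath (s z : Vertex) : Set where
    field
      steps      : TransClosure TimeArc s z
      distinct   : Unique (pathVertices steps)
      increasing : Linked _<_ (times steps)

    -- No truncation occurs, since the times increase along the path.
    duration : ℕ
    duration = lastTime steps + 1 ∸ firstTime steps

  open TemporalPath

  IsFastest : ∀ {s z} → TemporalPath s z → Set
  IsFastest {s} {z} p = ∀ (q : TemporalPath s z) → duration p ≤ duration q

record DiTTR (Δ k : ℕ) : Set where
  field
    tree   : SimpleGraph
    isTree : IsTree tree

  open SimpleGraph tree public using (Vertex; Adj; adj-sym)

  graph : Digraph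
  graph = bidirected tree

  field
    D          : Vertex → Vertex → ℕ ⁺
    D-positive : ∀ u v → [ 1 ] ≤⁺ D u v
    D-slack    : ∀ u v → u ≢ v →
                 ∃[ d ] IsDistance graph u v d × [ d + k ] ≤⁺ D u v

  Valid : Labeling graph Δ → Set
  Valid lab = ∀ u v → u ≢ v →
    Σ[ p ∈ TemporalPath graph lab u v ]
      IsFastest graph lab p × [ TemporalPath.duration p ] ≤⁺ D u v

  Realizable : Set
  Realizable = ∃[ lab ] Valid lab

  EnforcesEqual : ∀ v₁ v₂ → Adj v₁ v₂ → Set
  EnforcesEqual v₁ v₂ e =
    ∀ lab → Valid lab → lab v₁ v₂ e ≡ lab v₂ v₁ (adj-sym e)

-- The tree is a path with one end vertex doubled, and D is the distance
-- itself, so that the labels along every path are consecutive modulo Δ.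
-- Let c be the fork, x and x′ its two leaves and y its third neighbour.
-- Comparing x′ → c → x with x′ → c → y gives λ(c,x) = λ(c,y).  Moving away
-- from the fork, the outward label increases and the inward one decreases by
-- one per edge, so that their difference, which is λ(c,y) − λ(y,c) = 1 at
-- first, grows by 2 per edge.  When Δ = 2m + 1 it is Δ after m edges.
module Submission where

open import Defs
open import Data.Bool using (T; _∨_)
open import Data.Bool.Properties using (T-∨; T-irrelevant)
open import Data.Fin using (Fin; zero; suc; toℕ; fromℕ<; _≟_)
open import Data.Fin.Properties using (toℕ-fromℕ<; toℕ-injective; toℕ<n)
open import Data.List using ([]; _∷_)
open import Data.List.Relation.Unary.All using (All; []; _∷_)
import Data.List.Relation.Unary.AllPairs as AllPairs
open import Data.List.Relation.Unary.AllPairs using ([]; _∷_)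
open import Data.List.Relation.Unary.Linked using (Linked; [-]; _∷_)
open import Data.List.Relation.Unary.Linked.Properties using (Linked⇒AllPairs)
open import Data.List.Relation.Unary.Unique.Propositional using (Unique)
open import Data.Nat using (ℕ; zero; suc; _+_; _*_; _∸_; _≤_; _<_; _%_; _/_; _≡ᵇ_; _<?_; ∣_-_∣; NonZero; z≤n; s≤s; s≤s⁻¹; compare; less; equal; greater)
open import Data.Nat.DivMod using (_mod_; m%n%n≡m%n; m≡m%n+[m/n]*n; m%n<n; m<n⇒m%n≡m; [m+n]%n≡m%n; [m+kn]%n≡m%n; %-distribˡ-+)
open import Data.Nat.Properties hiding (_≟_)
open import Data.Nat.Tactic.RingSolver using (solve-∀)
open import Data.Product using (Σ-syntax; ∃-syntax; _×_; _,_; proj₁)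
open import Data.Sum using (_⊎_; inj₁; inj₂; swap)
open import Function using (_on_; _∘_)
open import Function.Bundles using (Equivalence)
open import Level using (0ℓ)
open import Relation.Binary using (Rel)
open import Relation.Binary.Construct.Add.Supremum.NonStrict _≤_ using ([_]; [≤]-injective)
open import Relation.Binary.Construct.Closure.ReflexiveTransitive using (Star; ε; _◅_)
open import Relation.Binary.Construct.Closure.Transitive using (TransClosure; [_]; _∷_)
open import Relation.Binary.PropositionalEquality
open import Relation.Nullary using (¬_; yes; no; contradiction)
open import Relation.Nullary.Construct.Add.Supremum using ([_])

module _ {G : Digraph} {Δ : ℕ} {lab : Labeling G Δ} where
  open Digraph G
  open TimeArc
  open TemporalPath

  timeArc : .{{_ : NonZero Δ}} → ∀ {u v} (e : Arc u v) t →
            toℕ (lab u v e) ≡ t % Δ → TimeArc G lab u v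
  timeArc e t eq = record
    { arc    = e
    ; time   = t
    ; active = t / Δ , trans (m≡m%n+[m/n]*n t Δ) (cong (_+ t / Δ * Δ) (sym eq))
    }

  time%Δ : .{{_ : NonZero Δ}} → ∀ {u v} (a : TimeArc G lab u v) →
           time a % Δ ≡ toℕ (lab u v (arc a))
  time%Δ {u} {v} a with i , eq ← active a = begin
    time a % Δ                          ≡⟨ cong (_% Δ) eq ⟩
    (toℕ (lab u v (arc a)) + i * Δ) % Δ ≡⟨ [m+kn]%n≡m%n (toℕ (lab u v (arc a))) i Δ ⟩
    toℕ (lab u v (arc a)) % Δ           ≡⟨ m<n⇒m%n≡m (toℕ<n (lab u v (arc a))) ⟩
    toℕ (lab u v (arc a))               ∎
    where open ≡-Reasoning

  walk : ∀ {u v} → TransClosure (TimeArc G lab) u v → Star Arc u v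
  walk [ a ]   = arc a ◅ ε
  walk (a ∷ p) = arc a ◅ walk p

  0<length-walk : ∀ {u v} (p : TransClosure (TimeArc G lab) u v) →
                  0 < length (walk p)
  0<length-walk [ a ]   = s≤s z≤n
  0<length-walk (a ∷ p) = s≤s z≤n

  consTime : ∀ {u v t} (p : TransClosure (TimeArc G lab) u v) →
             t < firstTime G lab p → Linked _<_ (times G lab p) →
             Linked _<_ (t ∷ times G lab p)
  consTime [ a ]   t< inc = t< ∷ inc
  consTime (a ∷ p) t< inc = t< ∷ inc

  consVertex : ∀ {R : Rel Vertex 0ℓ} {u v w} (p : TransClosure (TimeArc G lab) w v) →
               R u w → Linked R (pathVertices G lab p) →
               Linked R (u ∷ pathVertices G lab p)
  consVertex [ a ]   Ruw asc = Ruw ∷ asc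
  consVertex (a ∷ p) Ruw asc = Ruw ∷ asc

  unconsTime : ∀ {u v t} (p : TransClosure (TimeArc G lab) u v) →
               Linked _<_ (t ∷ times G lab p) →
               t < firstTime G lab p × Linked _<_ (times G lab p)
  unconsTime [ a ]   (t< ∷ inc) = t< , inc
  unconsTime (a ∷ p) (t< ∷ inc) = t< , inc

  length+firstTime≤lastTime+1 : ∀ {u v} (p : TransClosure (TimeArc G lab) u v) →
    Linked _<_ (times G lab p) →
    length (walk p) + firstTime G lab p ≤ lastTime G lab p + 1
  length+firstTime≤lastTime+1 [ a ]   inc = ≤-reflexive (+-comm 1 (time a))
  length+firstTime≤lastTime+1 (a ∷ p) inc with t< , inc′ ← unconsTime p inc = begin
    suc (length (walk p) + time a)        ≡⟨ +-suc (length (walk p)) (time a) ⟨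
    length (walk p) + suc (time a)        ≤⟨ +-monoʳ-≤ (length (walk p)) t< ⟩
    length (walk p) + firstTime G lab p   ≤⟨ length+firstTime≤lastTime+1 p inc′ ⟩
    lastTime G lab p + 1                  ∎
    where open ≤-Reasoning

  length≤duration : ∀ {u v} (p : TemporalPath G lab u v) →
                    length (walk (steps p)) ≤ duration p
  length≤duration p = m+n≤o⇒m≤o∸n (length (walk (steps p)))
    (length+firstTime≤lastTime+1 (steps p) (increasing p))

  module Climb
    (rank : Vertex → ℕ)
    (hop  : ∀ {u v} → rank v ≡ 1 + rank u →
            Σ[ a ∈ TimeArc G lab u v ] time a ≡ rank u)
    (rise : ∀ {u v} d → rank v ≡ 2 + d + rank u → ∃[ w ] rank w ≡ 1 + rank u)
    where

    climb : ∀ d {u v} → rank v ≡ 1 + d + rank u →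
      Σ[ p ∈ TransClosure (TimeArc G lab) u v ]
        firstTime G lab p ≡ rank u × lastTime G lab p ≡ d + rank u ×
        Linked _<_ (times G lab p) × Linked (_<_ on rank) (pathVertices G lab p)
    climb zero eq with a , t ← hop eq =
      [ a ] , t , t , [-] , ≤-reflexive (sym eq) ∷ [-]
    climb (suc d) {u} eq
      with w , w≡ ← rise d eq
      with a , t ← hop w≡
      with p , first≡ , last≡ , inc , asc ←
           climb d (trans eq (cong suc (trans (sym (+-suc d (rank u))) (cong (d +_) (sym w≡)))))
      = a ∷ p , t
      , trans last≡ (trans (cong (d +_) w≡) (+-suc d (rank u)))
      , consTime p (≤-reflexive (trans (cong suc t) (trans (sym w≡) (sym first≡)))) inc
      , consVertex p (≤-reflexive (sym w≡)) asc

    climbPath : ∀ d {u v} → rank v ≡ 1 + d + rank u →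
      Σ[ p ∈ TemporalPath G lab u v ] duration p ≡ 1 + d
    climbPath d {u} eq with p , first≡ , last≡ , inc , asc ← climb d eq =
      record
        { steps      = p
        ; distinct   = AllPairs.map (λ u<v u≡v → <-irrefl (cong rank u≡v) u<v)
                         (Linked⇒AllPairs <-trans asc)
        ; increasing = inc
        } , (begin
      lastTime G lab p + 1 ∸ firstTime G lab p ≡⟨ cong₂ (λ l f → l + 1 ∸ f) last≡ first≡ ⟩
      d + rank u + 1 ∸ rank u                  ≡⟨ cong (_∸ rank u) (+-comm (d + rank u) 1) ⟩
      1 + d + rank u ∸ rank u                  ≡⟨ m+n∸n≡m (1 + d) (rank u) ⟩
      1 + d                                    ∎)
      where open ≡-Reasoning

[m+n%d]%d≡[m+n]%d : ∀ m n d .{{_ : NonZero d}} → (m + n % d) % d ≡ (m + n) % d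
[m+n%d]%d≡[m+n]%d m n d = begin
  (m + n % d) % d           ≡⟨ %-distribˡ-+ m (n % d) d ⟩
  (m % d + n % d % d) % d   ≡⟨ cong (λ x → (m % d + x) % d) (m%n%n≡m%n n d) ⟩
  (m % d + n % d) % d       ≡⟨ %-distribˡ-+ m n d ⟨
  (m + n) % d               ∎
  where open ≡-Reasoning

module _ {G : SimpleGraph} (isTree : IsTree G) {Δ : ℕ} .{{_ : NonZero Δ}}
         {lab : Labeling (bidirected G) Δ} where
  open SimpleGraph G
  open IsTree isTree
  open TimeArc
  open TemporalPath

  private
    Adj⇒≢ : ∀ {u v} → Adj u v → u ≢ v
    Adj⇒≢ e refl = adj-irrefl e

  tight⇒consecutive : ∀ {u v w} (e : Adj u v) (f : Adj v w) → u ≢ w →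
    (p : TemporalPath (bidirected G) lab u w) → duration p ≤ 2 →
    toℕ (lab v w f) ≡ suc (toℕ (lab u v e)) % Δ
  tight⇒consecutive e f u≢w record { steps = [ a ] } _ =
    contradiction (adj-sym (arc a))
      (acyclic (e ◅ f ◅ ε)
        ((Adj⇒≢ e ∷ u≢w ∷ []) ∷ (Adj⇒≢ f ∷ []) ∷ [] ∷ []) ≤-refl)
  tight⇒consecutive e f u≢w p@record { steps = a ∷ b ∷ s } p≤2 =
    contradiction (≤-trans (length≤duration p) p≤2)
      (<⇒≱ (s≤s (s≤s (0<length-walk s))))
  tight⇒consecutive {u} {v} {w} e f u≢w
    record { steps = _∷_ {y = v′} a [ b ] ; increasing = a<b ∷ [-] } p≤2 with v ≟ v′
  ... | no v≢v′ = contradiction (adj-sym (arc a))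
    (acyclic (e ◅ f ◅ adj-sym (arc b) ◅ ε)
      ((Adj⇒≢ e ∷ u≢w ∷ Adj⇒≢ (arc a) ∷ [])
        ∷ (Adj⇒≢ f ∷ v≢v′ ∷ []) ∷ (≢-sym (Adj⇒≢ (arc b)) ∷ []) ∷ [] ∷ [])
      (s≤s (s≤s z≤n)))
  ... | yes refl = begin
    toℕ (lab v w f)                   ≡⟨ cong (toℕ ∘ lab v w) (T-irrelevant f (arc b)) ⟩
    toℕ (lab v w (arc b))             ≡⟨ time%Δ b ⟨
    time b % Δ                        ≡⟨ cong (_% Δ) (≤-antisym b≤1+a a<b) ⟩
    suc (time a) % Δ                  ≡⟨ [m+n%d]%d≡[m+n]%d 1 (time a) Δ ⟨
    suc (time a % Δ) % Δ              ≡⟨ cong (λ t → suc t % Δ) (time%Δ a) ⟩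
    suc (toℕ (lab u v (arc a))) % Δ   ≡⟨ cong (λ g → suc (toℕ (lab u v g)) % Δ) (T-irrelevant (arc a) e) ⟩
    suc (toℕ (lab u v e)) % Δ         ∎
    where
    open ≡-Reasoning
    b≤1+a : time b ≤ suc (time a)
    b≤1+a = s≤s⁻¹ (subst₂ _≤_ (+-comm (time b) 1) (+-comm (time a) 2)
      (≤-trans (m≤n+m∸n (time b + 1) (time a)) (+-monoʳ-≤ (time a) p≤2)))

-- The value at 0 is the distance between the two copies of the doubled end,
-- the only distinct vertices of equal height.
spread : ℕ → ℕ
spread zero    = 2
spread (suc n) = suc n

-- The height is the position along the path, in which the vertices 0 and 1
-- are the two copies of the doubled end.
module Fork (m Δ : ℕ) (Δ≡1+m*2 : Δ ≡ suc (m * 2)) where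

  instance
    Δ-nonZero : NonZero Δ
    Δ-nonZero = subst NonZero (sym Δ≡1+m*2) _

  levels : ℕ
  levels = 3 + m

  Node : Set
  Node = Fin (suc levels)

  height : Node → ℕ
  height zero    = 0
  height (suc i) = toℕ i

  height<levels : ∀ u → height u < levels
  height<levels zero    = s≤s z≤n
  height<levels (suc i) = toℕ<n i

  atHeight : ∀ {k} → k < levels → ∃[ u ] height u ≡ k
  atHeight k< = suc (fromℕ< k<) , toℕ-fromℕ< k<

  height-injective : ∀ {u v k} → height u ≡ suc k → height v ≡ suc k → u ≡ v
  height-injective {suc i} {suc j} eq₁ eq₂ =
    cong suc (toℕ-injective (trans eq₁ (sym eq₂)))

  leaf : ∀ {u v} → height u ≡ height v → u ≢ v → height u ≡ 0
  leaf {u} eq u≢v with height u in hu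
  ... | zero  = refl
  ... | suc k = contradiction (height-injective hu (sym eq)) u≢v

  adj? : Node → Node → _
  adj? u v = (height v ≡ᵇ suc (height u)) ∨ (height u ≡ᵇ suc (height v))

  Adj : Rel Node _
  Adj u v = T (adj? u v)

  toAdj : ∀ {u v} → height v ≡ suc (height u) ⊎ height u ≡ suc (height v) → Adj u v
  toAdj (inj₁ eq) = Equivalence.from T-∨ (inj₁ (≡⇒≡ᵇ _ _ eq))
  toAdj {u} {v} (inj₂ eq) =
    Equivalence.from (T-∨ {height v ≡ᵇ suc (height u)}) (inj₂ (≡⇒≡ᵇ _ _ eq))

  fromAdj : ∀ {u v} → Adj u v → height v ≡ suc (height u) ⊎ height u ≡ suc (height v)
  fromAdj {u} {v} e with Equivalence.to (T-∨ {height v ≡ᵇ suc (height u)}) e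
  ... | inj₁ t = inj₁ (≡ᵇ⇒≡ _ _ t)
  ... | inj₂ t = inj₂ (≡ᵇ⇒≡ _ _ t)

  tree : SimpleGraph
  tree = record
    { order      = suc levels
    ; adj?       = adj?
    ; adj-sym    = λ {u} {v} e → toAdj {v} {u} (swap (fromAdj {u} {v} e))
    ; adj-irrefl = λ {u} e → irrefl (fromAdj {u} {u} e)
    }
    where
    irrefl : ∀ {n} → ¬ (n ≡ suc n ⊎ n ≡ suc n)
    irrefl (inj₁ ())
    irrefl (inj₂ ())

  depth : Node → ℕ
  depth u = 2 + Δ ∸ height u

  depth+height : ∀ u → depth u + height u ≡ 2 + Δ
  depth+height u = m∸n+n≡m (≤-trans (s≤s⁻¹ (height<levels u))
    (+-monoʳ-≤ 2 (≤-trans (m≤n⇒m≤1+n (m≤m*n m 2)) (≤-reflexive (sym Δ≡1+m*2)))))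

  depth⇒height : ∀ {u v} k → depth v ≡ k + depth u → height u ≡ k + height v
  depth⇒height {u} {v} k eq = +-cancelˡ-≡ (depth u) _ _ (begin
    depth u + height u       ≡⟨ trans (depth+height u) (sym (depth+height v)) ⟩
    depth v + height v       ≡⟨ cong (_+ height v) eq ⟩
    k + depth u + height v   ≡⟨ shuffle k (depth u) (height v) ⟩
    depth u + (k + height v) ∎)
    where
    open ≡-Reasoning
    shuffle : ∀ k d h → k + d + h ≡ d + (k + h)
    shuffle = solve-∀

  height⇒depth : ∀ {u v} k → height u ≡ k + height v → depth v ≡ k + depth u
  height⇒depth {u} {v} k eq = +-cancelʳ-≡ (height v) _ _ (begin
    depth v + height v       ≡⟨ trans (depth+height v) (sym (depth+height u)) ⟩
    depth u + height u       ≡⟨ cong (depth u +_) eq ⟩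
    depth u + (k + height v) ≡⟨ shuffle k (depth u) (height v) ⟩
    k + depth u + height v   ∎)
    where
    open ≡-Reasoning
    shuffle : ∀ k d h → d + (k + h) ≡ k + d + h
    shuffle = solve-∀

  labeling : Labeling (bidirected tree) Δ
  labeling u v _ with height u <? height v
  ... | yes _ = height u mod Δ
  ... | no  _ = depth u mod Δ

  up-label : ∀ {u v} (e : Adj u v) → height v ≡ suc (height u) →
             toℕ (labeling u v e) ≡ height u % Δ
  up-label {u} {v} e eq with height u <? height v
  ... | yes _ = toℕ-fromℕ< (m%n<n (height u) Δ)
  ... | no ≮  = contradiction (≤-reflexive (sym eq)) ≮

  down-label : ∀ {u v} (e : Adj u v) → height u ≡ suc (height v) →
               toℕ (labeling u v e) ≡ depth u % Δ
  down-label {u} {v} e eq with height u <? height v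
  ... | yes < = contradiction (≤-reflexive (sym eq)) (<-asym <)
  ... | no _  = toℕ-fromℕ< (m%n<n (depth u) Δ)

  TA : Node → Node → Set
  TA = TimeArc (bidirected tree) labeling

  up : ∀ {u v} → height v ≡ suc (height u) →
       Σ[ a ∈ TA u v ] TimeArc.time a ≡ height u
  up {u} {v} eq = timeArc e (height u) (up-label {u} {v} e eq) , refl
    where
    e : Adj u v
    e = toAdj {u} {v} (inj₁ eq)

  down : ∀ {u v} → depth v ≡ suc (depth u) →
         Σ[ a ∈ TA u v ] TimeArc.time a ≡ depth u
  down {u} {v} eq = timeArc e (depth u) (down-label {u} {v} e h≡) , refl
    where
    h≡ : height u ≡ suc (height v)
    h≡ = depth⇒height {u} {v} 1 eq
    e : Adj u v
    e = toAdj {u} {v} (inj₂ h≡)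

  up-rise : ∀ {u v} d → height v ≡ 2 + d + height u → ∃[ w ] height w ≡ 1 + height u
  up-rise {u} {v} d eq = atHeight (begin-strict
    1 + height u     <⟨ s≤s (s≤s (m≤n+m (height u) d)) ⟩
    2 + d + height u ≡⟨ eq ⟨
    height v         <⟨ height<levels v ⟩
    levels           ∎)
    where open ≤-Reasoning

  down-rise : ∀ {u v} d → depth v ≡ 2 + d + depth u → ∃[ w ] depth w ≡ 1 + depth u
  down-rise {u} {v} d eq with h≡ ← depth⇒height {u} {v} (2 + d) eq
    with w , w≡ ← atHeight {1 + d + height v}
                    (<-trans (≤-reflexive (sym h≡)) (height<levels u))
    = w , height⇒depth {u} {w} 1 (trans h≡ (cong suc (sym w≡)))

  distance : Node → Node → ℕ
  distance u v = spread ∣ height u - height v ∣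

  TP : Node → Node → Set
  TP = TemporalPath (bidirected tree) labeling

  -- The two labels are 0 and 1 + Δ before reduction: leaving at time Δ rather
  -- than 0 makes the times consecutive.
  detour : ∀ {u v} → height u ≡ 0 → height v ≡ 0 → u ≢ v →
           Σ[ p ∈ TP u v ] TemporalPath.duration p ≡ 2
  detour {u} {v} hu hv u≢v = record
    { steps      = timeArc {u = u} {v = c} u→c Δ
                     (trans (up-label {u} {c} u→c (cong suc (sym hu)))
                       (trans (cong (_% Δ) hu) (sym ([m+n]%n≡m%n 0 Δ))))
                 ∷ [ timeArc {u = c} {v = v} c→v (suc Δ)
                       (down-label {c} {v} c→v (cong suc (sym hv))) ]
    ; distinct   = (u≢c ∷ u≢v ∷ []) ∷ (c≢v ∷ []) ∷ [] ∷ []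
    ; increasing = ≤-refl ∷ [-]
    } , (begin
      suc Δ + 1 ∸ Δ ≡⟨ cong (_∸ Δ) (+-comm (suc Δ) 1) ⟩
      2 + Δ ∸ Δ     ≡⟨ m+n∸n≡m 2 Δ ⟩
      2             ∎)
    where
    open ≡-Reasoning
    c : Node
    c = suc (suc zero)
    u→c : Adj u c
    u→c = toAdj {u} {c} (inj₁ (cong suc (sym hu)))
    c→v : Adj c v
    c→v = toAdj {c} {v} (inj₂ (cong suc (sym hv)))
    u≢c : u ≢ c
    u≢c u≡c with () ← trans (sym hu) (cong height u≡c)
    c≢v : c ≢ v
    c≢v c≡v with () ← trans (cong height c≡v) hv

  gap : ∀ m n → (∃[ d ] n ≡ 1 + d + m) ⊎ m ≡ n ⊎ (∃[ d ] m ≡ 1 + d + n)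
  gap m n with compare m n
  ... | less m k    = inj₁ (k , cong suc (+-comm m k))
  ... | equal m     = inj₂ (inj₁ refl)
  ... | greater n k = inj₂ (inj₂ (k , cong suc (+-comm n k)))

  distance-up : ∀ {u v} d → height v ≡ 1 + d + height u → distance u v ≡ 1 + d
  distance-up {u} {v} d eq = cong spread
    (trans (cong (∣ height u -_∣) (trans eq (+-comm (1 + d) (height u))))
      (∣m-m+n∣≡n (height u) (1 + d)))

  distance-sym : ∀ u v → distance u v ≡ distance v u
  distance-sym u v = cong spread (∣-∣-comm (height u) (height v))

  distance-leaf : ∀ {u v} → height u ≡ height v → distance u v ≡ 2
  distance-leaf eq = cong spread (m≡n⇒∣m-n∣≡0 eq)

  TightPath : Node → Node → Set
  TightPath u v = Σ[ p ∈ TP u v ] TemporalPath.duration p ≡ distance u v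

  ascent : ∀ {u v} d → height v ≡ 1 + d + height u → TightPath u v
  ascent {u} {v} d eq =
    let p , p≡ = Climb.climbPath height (λ {u} {v} → up {u} {v})
                   (λ {u} {v} → up-rise {u} {v}) d {u} {v} eq
    in  p , trans p≡ (sym (distance-up {u} {v} d eq))

  descent : ∀ {u v} d → height u ≡ 1 + d + height v → TightPath u v
  descent {u} {v} d eq =
    let p , p≡ = Climb.climbPath depth (λ {u} {v} → down {u} {v})
                   (λ {u} {v} → down-rise {u} {v}) d {u} {v}
                   (height⇒depth {u} {v} (1 + d) eq)
    in  p , trans p≡ (sym (trans (distance-sym u v) (distance-up {v} {u} d eq)))

  tightPath : ∀ u v → u ≢ v → TightPath u v
  tightPath u v u≢v with gap (height u) (height v)
  ... | inj₁ (d , eq)        = ascent {u} {v} d eq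
  ... | inj₂ (inj₂ (d , eq)) = descent {u} {v} d eq
  ... | inj₂ (inj₁ eq)       =
    let hu     = leaf {u} {v} eq u≢v
        p , p≡ = detour {u} {v} hu (trans (sym eq) hu) u≢v
    in  p , trans p≡ (sym (distance-leaf {u} {v} eq))

  distance≤length : ∀ {u v} → u ≢ v → (w : Star Adj u v) → distance u v ≤ length w
  distance≤length u≢v ε = contradiction refl u≢v
  distance≤length {u} {v} u≢v (e ◅ ε) with fromAdj {u} {v} e
  ... | inj₁ eq = ≤-reflexive (distance-up {u} {v} 0 eq)
  ... | inj₂ eq = ≤-reflexive (trans (distance-sym u v) (distance-up {v} {u} 0 eq))
  distance≤length {u} {v} u≢v w@(_ ◅ _ ◅ _) =
    spread≤ (s≤s (s≤s z≤n)) (difference≤length w)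
    where
    spread≤ : ∀ {n l} → 2 ≤ l → n ≤ l → spread n ≤ l
    spread≤ {zero}  2≤l n≤l = 2≤l
    spread≤ {suc n} 2≤l n≤l = n≤l
    ∣n-1+n∣≡1 : ∀ n → ∣ n - suc n ∣ ≡ 1
    ∣n-1+n∣≡1 n = trans (cong (∣ n -_∣) (+-comm 1 n)) (∣m-m+n∣≡n n 1)
    step : ∀ {u v} → Adj u v → ∣ height u - height v ∣ ≤ 1
    step {u} {v} e with fromAdj {u} {v} e
    ... | inj₁ eq rewrite eq = ≤-reflexive (∣n-1+n∣≡1 (height u))
    ... | inj₂ eq rewrite eq = ≤-reflexive
      (trans (∣-∣-comm (suc (height v)) (height v)) (∣n-1+n∣≡1 (height v)))
    difference≤length : ∀ {u v} (w : Star Adj u v) → ∣ height u - height v ∣ ≤ length w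
    difference≤length {u} ε = ≤-reflexive (∣n-n∣≡0 (height u))
    difference≤length {u} {v} (_◅_ {j = x} e w) = ≤-trans
      (∣-∣-triangle (height u) (height x) (height v))
      (+-mono-≤ (step {u} {x} e) (difference≤length w))

  start : ∀ {P : Node → Set} {u v} (p : Star Adj u v) → All P (vertices p) → P u
  start ε       (Pu ∷ _) = Pu
  start (_ ◅ _) (Pu ∷ _) = Pu

  simple-up : ∀ {u v w} (p : Star Adj v w) → height v ≡ suc (height u) →
    Unique (u ∷ vertices p) →
    height w ≡ suc (length p) + height u ⊎ height w ≡ height u × height u ≡ 0
  simple-up ε eq _ = inj₁ eq
  simple-up {u} {v} (_◅_ {j = x} f p) eq (u∉ ∷ v∉ ∷ uniq) with fromAdj {v} {x} f
  simple-up {u} {v} (_◅_ {j = x} f p) eq (u∉ ∷ v∉ ∷ uniq) | inj₁ x≡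
    with simple-up p x≡ (v∉ ∷ uniq)
  ... | inj₁ w≡       = inj₁ (trans w≡ (trans (cong (suc (length p) +_) eq)
                                        (+-suc (suc (length p)) (height u))))
  ... | inj₂ (_ , v≡0) with () ← trans (sym eq) v≡0
  simple-up {u} {v} (_◅_ {j = x} f p) eq ((_ ∷ u∉) ∷ v∉ ∷ uniq) | inj₂ x≡
    with u≡x ← suc-injective (trans (sym eq) x≡)
    with u≡0 ← leaf {u} {x} u≡x (start p u∉)
    = inj₂ (at-leaf p v∉ , u≡0)
    where
    at-leaf : ∀ {w} (p : Star Adj x w) → All (v ≢_) (vertices p) → height w ≡ height u
    at-leaf ε v∉ = sym u≡x
    at-leaf (_◅_ {j = y} g q) (_ ∷ v∉) with fromAdj {x} {y} g
    ... | inj₁ y≡ = contradiction (height-injective x≡ y≡) (start q v∉)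
    ... | inj₂ y≡ with () ← trans (sym y≡) (trans (sym u≡x) u≡0)

  simple-down : ∀ {u v w} (p : Star Adj v w) → height u ≡ suc (height v) →
    Unique (u ∷ vertices p) → height u ≡ suc (length p) + height w
  simple-down ε eq _ = eq
  simple-down {u} {v} (_◅_ {j = x} f p) eq ((_ ∷ u∉) ∷ uniq) with fromAdj {v} {x} f
  ... | inj₁ x≡ = contradiction (height-injective eq x≡) (start p u∉)
  ... | inj₂ v≡ = trans eq (cong suc (simple-down p v≡ uniq))

  acyclic : ∀ {u v} (p : Star Adj u v) → Unique (vertices p) → 2 ≤ length p → ¬ Adj v u
  acyclic {u} {v} (_◅_ {j = x} e p@(_ ◅ _)) uniq (s≤s 1≤) f
    with fromAdj {u} {x} e | fromAdj {v} {u} f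
  ... | inj₁ x≡ | f≡ = absurd-up (simple-up p x≡ uniq) f≡
    where
    absurd-up : height v ≡ suc (length p) + height u ⊎ height v ≡ height u × _ →
                height u ≡ suc (height v) ⊎ height v ≡ suc (height u) → _
    absurd-up (inj₁ v≡) (inj₁ u≡) = m≢1+n+m (height u) (trans u≡ (cong suc v≡))
    absurd-up (inj₁ v≡) (inj₂ v≡′) =
      m≢1+n+m (height u) (suc-injective (trans (sym v≡′) v≡))
    absurd-up (inj₂ (v≡ , _)) (inj₁ u≡)  = 1+n≢n (sym (trans u≡ (cong suc v≡)))
    absurd-up (inj₂ (v≡ , _)) (inj₂ v≡′) = 1+n≢n (trans (sym v≡′) v≡)
  ... | inj₂ u≡ | inj₁ u≡′ =
    m≢1+n+m (height v) (suc-injective (trans (sym u≡′) (simple-down p u≡ uniq)))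
  ... | inj₂ u≡ | inj₂ v≡ =
    m≢1+n+m (height v) (trans v≡ (cong suc (simple-down p u≡ uniq)))

  isTree : IsTree tree
  isTree = record
    { nonempty  = _
    ; connected = connected
    ; acyclic   = acyclic
    }
    where
    connected : ∀ u v → Star Adj u v
    connected u v with u ≟ v
    ... | yes refl = ε
    ... | no u≢v   = walk (TemporalPath.steps (proj₁ (tightPath u v u≢v)))

  distance≤duration : ∀ {lab u v} → u ≢ v → (p : TemporalPath (bidirected tree) {Δ} lab u v) →
                      distance u v ≤ TemporalPath.duration p
  distance≤duration u≢v p =
    ≤-trans (distance≤length u≢v (walk (TemporalPath.steps p))) (length≤duration p)

  isDistance : ∀ {u v} → u ≢ v → IsDistance (bidirected tree) u v (distance u v)
  isDistance {u} {v} u≢v =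
    let p , p≡ = tightPath u v u≢v
        w      = walk (TemporalPath.steps p)
    in  (w , ≤-antisym (≤-trans (length≤duration p) (≤-reflexive p≡))
                       (distance≤length u≢v w))
      , distance≤length u≢v

  gadget : DiTTR Δ 0
  gadget = record
    { tree       = tree
    ; isTree     = isTree
    ; D          = λ u v → [ distance u v ]
    ; D-positive = λ u v → [ 1≤spread ∣ height u - height v ∣ ]
    ; D-slack    = λ u v u≢v → distance u v , isDistance u≢v
                             , [ ≤-reflexive (+-identityʳ (distance u v)) ]
    }
    where
    1≤spread : ∀ n → 1 ≤ spread n
    1≤spread zero    = s≤s z≤n
    1≤spread (suc n) = s≤s z≤n

  labeling-valid : DiTTR.Valid gadget labeling
  labeling-valid u v u≢v =
    let p , p≡ = tightPath u v u≢v
    in  p , (λ q → ≤-trans (≤-reflexive p≡) (distance≤duration u≢v q))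
          , [ ≤-reflexive p≡ ]

  module _ (lab : Labeling (bidirected tree) Δ) (valid : DiTTR.Valid gadget lab) where

    label : ∀ {u v} → Adj u v → ℕ
    label {u} {v} e = toℕ (lab u v e)

    consecutive : ∀ {u v w} (e : Adj u v) (f : Adj v w) → u ≢ w →
                  distance u w ≡ 2 → label {v} {w} f ≡ suc (label {u} {v} e) % Δ
    consecutive {u} {v} {w} e f u≢w d≡2 =
      let p , _ , p≤ = valid u w u≢w
      in  tight⇒consecutive isTree {u = u} {v} {w} e f u≢w p
            (≤-trans ([≤]-injective p≤) (≤-reflexive d≡2))

    consecutive-up : ∀ {u v w} (e : Adj u v) (f : Adj v w) → height w ≡ 2 + height u →
                     label {v} {w} f ≡ suc (label {u} {v} e) % Δ
    consecutive-up {u} {v} {w} e f w≡ = consecutive {u} {v} {w} e f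
      (λ u≡w → m≢1+n+m (height u) (trans (cong height u≡w) w≡))
      (distance-up {u} {w} 1 w≡)

    consecutive-down : ∀ {u v w} (e : Adj u v) (f : Adj v w) → height u ≡ 2 + height w →
                       label {v} {w} f ≡ suc (label {u} {v} e) % Δ
    consecutive-down {u} {v} {w} e f u≡ = consecutive {u} {v} {w} e f
      (λ u≡w → m≢1+n+m (height w) (trans (cong height (sym u≡w)) u≡))
      (trans (distance-sym u w) (distance-up {w} {u} 1 u≡))

    x x′ c : Node
    x  = zero
    x′ = suc zero
    c  = suc (suc zero)

    cx : ℕ
    cx = label {c} {x} _

    outward : ∀ k {u v} (e : Adj u v) → height u ≡ 1 + k → height v ≡ 2 + k →
              label {u} {v} e ≡ (k + cx) % Δ
    outward zero {u} {v} e u≡ v≡ with refl ← height-injective {u} {c} u≡ refl = begin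
      label {c} {v} e            ≡⟨ consecutive-up {x′} {c} {v} _ e v≡ ⟩
      suc (label {x′} {c} _) % Δ ≡⟨ consecutive {x′} {c} {x} _ _ (λ ()) refl ⟨
      cx                         ≡⟨ m<n⇒m%n≡m (toℕ<n (lab c x _)) ⟨
      cx % Δ                     ∎
      where open ≡-Reasoning
    outward (suc k) {u} {v} e u≡ v≡ =
      let w , w≡ = atHeight {1 + k} (<-trans (≤-reflexive (sym u≡)) (height<levels u))
          d      = toAdj {w} {u} (inj₁ (trans u≡ (cong suc (sym w≡))))
      in begin
      label {u} {v} e             ≡⟨ consecutive-up {w} {u} {v} d e (trans v≡ (cong (2 +_) (sym w≡))) ⟩
      suc (label {w} {u} d) % Δ   ≡⟨ cong (λ l → suc l % Δ) (outward k {w} {u} d w≡ u≡) ⟩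
      suc ((k + cx) % Δ) % Δ      ≡⟨ [m+n%d]%d≡[m+n]%d 1 (k + cx) Δ ⟩
      suc (k + cx) % Δ            ∎
      where open ≡-Reasoning

    inward : ∀ k {u v} (e : Adj v u) → height u ≡ 1 + k → height v ≡ 2 + k →
             cx ≡ (1 + k + label {v} {u} e) % Δ
    inward zero {u} {v} e u≡ v≡ with refl ← height-injective {u} {c} u≡ refl =
      consecutive-down {v} {c} {x} e _ v≡
    inward (suc k) {u} {v} e u≡ v≡ =
      let w , w≡ = atHeight {1 + k} (<-trans (≤-reflexive (sym u≡)) (height<levels u))
          d      = toAdj {u} {w} (inj₂ (trans u≡ (cong suc (sym w≡))))
          l      = label {v} {u} e
      in begin
      cx                              ≡⟨ inward k {w} {u} d w≡ u≡ ⟩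
      (1 + k + label {u} {w} d) % Δ   ≡⟨ cong (λ l → (1 + k + l) % Δ)
                                            (consecutive-down {v} {u} {w} e d (trans v≡ (cong (2 +_) (sym w≡)))) ⟩
      (1 + k + suc l % Δ) % Δ         ≡⟨ [m+n%d]%d≡[m+n]%d (1 + k) (suc l) Δ ⟩
      (1 + k + suc l) % Δ             ≡⟨ cong (_% Δ) (+-suc (1 + k) l) ⟩
      (2 + k + l) % Δ                 ∎
      where open ≡-Reasoning

    equal-labels : ∀ {u v} (e : Adj u v) (f : Adj v u) →
      height u ≡ 1 + m → height v ≡ 2 + m → lab u v e ≡ lab v u f
    equal-labels {u} {v} e f u≡ v≡ = toℕ-injective (begin
      label {u} {v} e             ≡⟨ outward m {u} {v} e u≡ v≡ ⟩
      (m + cx) % Δ                ≡⟨ cong (λ l → (m + l) % Δ) (inward m {u} {v} f u≡ v≡) ⟩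
      (m + (1 + m + l) % Δ) % Δ   ≡⟨ [m+n%d]%d≡[m+n]%d m (1 + m + l) Δ ⟩
      (m + (1 + m + l)) % Δ       ≡⟨ cong (_% Δ) (collect m l) ⟩
      (l + suc (m * 2)) % Δ       ≡⟨ cong (λ n → (l + n) % Δ) Δ≡1+m*2 ⟨
      (l + Δ) % Δ                 ≡⟨ [m+n]%n≡m%n l Δ ⟩
      l % Δ                       ≡⟨ m<n⇒m%n≡m (toℕ<n (lab v u f)) ⟩
      l                           ∎)
      where
      open ≡-Reasoning
      l : ℕ
      l = label {v} {u} f
      collect : ∀ m l → m + (1 + m + l) ≡ l + suc (m * 2)
      collect = solve-∀

  enforces : ∃[ v₁ ] ∃[ v₂ ] Σ[ e ∈ Adj v₁ v₂ ] DiTTR.EnforcesEqual gadget v₁ v₂ e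
  enforces =
    let u , u≡ = atHeight {1 + m} (s≤s (s≤s (n≤1+n m)))
        v , v≡ = atHeight {2 + m} ≤-refl
        e      = toAdj {u} {v} (inj₁ (trans v≡ (cong suc (sym u≡))))
    in  u , v , e , λ lab valid →
          equal-labels lab valid {u} {v} e (SimpleGraph.adj-sym tree {u} {v} e) u≡ v≡

lemma14 : ∀ (Δ : ℕ) → 1 ≤ Δ → Δ % 2 ≡ 1 →
    Σ[ I ∈ DiTTR Δ 0 ] (DiTTR.Realizable I ×
    (∃[ v₁ ] ∃[ v₂ ] Σ[ e ∈ DiTTR.Adj I v₁ v₂ ] DiTTR.EnforcesEqual I v₁ v₂ e))
lemma14 Δ _ odd = gadget , (labeling , labeling-valid) , enforces
  where
  open Fork (Δ / 2) Δ (trans (m≡m%n+[m/n]*n Δ 2) (cong (_+ Δ / 2 * 2) odd))
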